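{- For every partition $\lambda$ and every $n\ge2$, $$\mathbb{F}_\lambda(\kappa_1,\dots,\kappa_{n-1},s_n\xi_n\mid\Xi,\mathsf{S})=\mathbb{F}_\lambda(\kappa_1,\dots,\kappa_{n-1}\mid\Xi,\mathsf{S}).$$
   Context: Fix a generic parameter $q$, and write $(x;q)_n:=\prod_{i=1}^n(1-xq^{i-1})$, $(x;q)_0:=1$. A partition is a weakly decreasing sequence $\lambda=(\lambda_1\ge\lambda_2\ge\dots\ge0)$ of nonnegative integers with finitely many nonzero entries; $\varnothing$ is the zero partition, $l(\lambda)$ is the number of nonzero parts and $\lambda'$ is the conjugate partition, so the number of parts of $\lambda'$ equal to $j$ is $m_j(\lambda')=\lambda_j-\lambda_{j+1}$. Let $\Xi=(\xi_0,\xi_1,\dots)$ and $\mathsf{S}=(s_0,s_1,\dots)$ be sequences of generic parameters, with fixed square roots $\sqrt{\xi_i},\sqrt{s_i}$. For $k\ge0$ put $s_i^{(k)}:=\sqrt{s_{i+k}\xi_{i+k}s_i/\xi_i}$ (formed from the fixed roots) and $\tau^k_{\Xi}\mathsf{S}:=(s^{(k)}_0,s^{(k)}_1,\dots)$. Vertex weights: for $i,j,k,l\in\mathbb{Z}_{\ge0}$ (labels of the bottom, left, top, right edge), $$W_{t,s}(i,j;k,l):=\mathbf{1}_{i+j=k+l}\,\mathbf{1}_{i\ge l}\,(s^2/t^2)^{l}\frac{(s^2/t^2;q)_{i-l}(t^2;q)_l}{(s^2;q)_i}\frac{(q;q)_i}{(q;q)_{i-l}(q;q)_l},$$ which depends only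 on $t^2,s^2$. Partition function: for $a_1,\dots,a_n\in\mathbb{Z}_{\ge0}$ and $L>l(\lambda),l(\mu)$, $$ZW^{(a_1,\dots,a_n)}_{\lambda/\mu}(\kappa_1,\dots,\kappa_n\mid\Xi,\mathsf{S}):=\sum\prod_{r=1}^n\prod_{c=1}^L W_{t_{r,c},\,s^{(r)}_c}(v_{r,c},h_{r,c-1};v_{r-1,c},h_{r,c}),\qquad t_{r,c}^2=\frac{\xi_{r+c}s_{r+c}}{\kappa_r},$$ where the sum is over all nonnegative integers $v_{r,c}$ ($0\le r\le n$, $1\le c\le L$) and $h_{r,c}$ ($1\le r\le n$, $0\le c\le L$) subject to $v_{0,c}=m_c(\lambda')$, $v_{n,c}=m_c(\mu')$, $h_{r,0}=a_r$, $h_{r,L}=0$; the result does not depend on $L$. Set $$\mathbb{F}^{\mathsf s}_{\lambda/\mu}(\kappa_1,\dots,\kappa_n\mid\Xi,\mathsf{S}):=\sum_{a_1+\dots+a_n=\lambda_1-\mu_1}\Bigl(\prod_{i=1}^n(\kappa_is_0/\xi_0)^{a_i}\frac{(\kappa_i^{ -1}s_i\xi_i;q)_{a_i}}{(q;q)_{a_i}}\Bigr)ZW^{(a_1,\dots,a_n)}_{\lambda/\mu}(\kappa_1,\dots,\kappa_n\mid\Xi,\mathsf{S}),$$ $$\mathbb{F}_{\lambda/\mu}(\kappa_1,\dots,\kappa_n\mid\Xi,\mathsf{S}):=\frac{(-\tau^n_\Xi\mathsf{S})^{\mu}}{(-\mathsf{S})^{\lambda}}\frac{\mathsf{c}_{\tau^n_\Xi\mathsf{S}}(\mu)}{\mathsf{c}_{\mathsf{S}}(\lambda)}\,\mathbb{F}^{\mathsf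 s}_{\lambda/\mu}(\kappa_1,\dots,\kappa_n\mid\Xi,\mathsf{S}),$$ where $\mathsf{c}_{\mathsf{S}}(\lambda):=\prod_{i\ge1}\frac{(s_i^2;q)_{\lambda_i-\lambda_{i+1}}}{(q;q)_{\lambda_i-\lambda_{i+1}}}$ and $(-\mathsf{S})^\lambda:=\prod_{i\ge1}(-s_{i-1})^{\lambda_i}$ (and likewise with $\mathsf S$ replaced by $\tau^n_\Xi\mathsf S$). These functions are polynomials in $\kappa_1,\dots,\kappa_n$. Finally $\mathbb{F}_\lambda:=\mathbb{F}_{\lambda/\varnothing}$. -}

module Defs where

open import Algebra.Apartness.Bundles using (HeytingCommutativeRing; HeytingField)
open import Algebra.Bundles using (CommutativeRing)
import Algebra.Apartness.Properties.HeytingCommutativeRing as HeytingProperties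
import Algebra.Properties.Monoid.Sum as FiniteSum
import Algebra.Properties.Semiring.Exp as Exponentiation
open import Data.Bool.Base using (if_then_else_)
open import Data.Fin.Base using (Fin; zero; suc; toℕ; fromℕ; inject₁)
open import Data.Fin.Properties using (all?)
open import Data.List.Base using (length; filter; upTo)
open import Data.Nat.Base as ℕ using (ℕ; zero; suc; _≤_; _∸_; _⊔_; z≤n)
open import Data.Nat.Properties using (_≟_; _≤?_)
open import Data.Product.Base using (∃; _×_; _,_; proj₁; proj₂)
open import Data.Vec.Base using (Vec; []; _∷_; lookup; sum)
open import Level using (Level) renaming (_⊔_ to _⊔ℓ_)
open import Relation.Binary.PropositionalEquality using (_≡_; refl)
open import Relation.Nullary.Decidable using (Dec; does; _×-dec_; ¬?)

-- Indices start at 0 here: `part i` is λᵢ₊₁.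
record Partition : Set where
  field
    part       : ℕ → ℕ
    decreasing : ∀ i → part (suc i) ≤ part i
    bound      : ℕ
    vanishing  : ∀ i → bound ≤ i → part i ≡ 0

  -- l(λ), the number of nonzero parts
  len : ℕ
  len = length (filter (λ i → ¬? (part i ≟ 0)) (upTo bound))

  -- `mult j` is m_{j+1}(λ′) = λ_{j+1} − λ_{j+2}; the truncated subtraction is
  -- exact because λ is weakly decreasing.
  mult : ℕ → ℕ
  mult j = part j ∸ part (suc j)

open Partition public using (part; len; mult)

∅ : Partition
∅ = record
  { part       = λ _ → 0
  ; decreasing = λ _ → z≤n
  ; bound      = 0
  ; vanishing  = λ _ _ → refl
  }

module OverField {c ℓ₁ ℓ₂ : Level} (F : HeytingField c ℓ₁ ℓ₂) where

  open HeytingField F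
    using ( Carrier; _#_; _+_; _*_; -_; _-_; 0#; 1#; heytingCommutativeRing
          ; #⇒invertible; #-sym; *-congˡ; *-congʳ; +-identityˡ )
    renaming (sym to ≈-sym; trans to ≈-trans)
  open HeytingCommutativeRing heytingCommutativeRing using (commutativeRing)
  open CommutativeRing commutativeRing using (semiring; +-monoid; *-monoid)
  open HeytingProperties heytingCommutativeRing
    using (x-0≈x; 1#0; x#0y#0→xy#0; invertibleˡ⇒#)
  open Exponentiation semiring using (_^_)
  open FiniteSum +-monoid using (sum⁺-syntax)
  open FiniteSum *-monoid using () renaming (sum to product)

  infixl 10 ∏-syntax

  ∏-syntax : ∀ n → (Fin n → Carrier) → Carrier
  ∏-syntax _ = product

  syntax ∏-syntax n (λ i → x) = ∏[ i < n ] x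

  infixl 7 _/_ _*×_ _/×_

  -- The elements by which one can divide.
  K× : Set (c ⊔ℓ ℓ₂)
  K× = ∃ λ x → x # 0#

  -- `#⇒invertible` supplies an inverse of x − 0, which is an inverse of x.
  recip : K× → K×
  recip (x , x#0) = y , invertibleˡ⇒# (x ,
    ≈-trans (*-congˡ (x-0≈x y)) (≈-trans (*-congʳ (≈-sym (x-0≈x x))) [x-0]y≈1))
    where
    y        = proj₁ (#⇒invertible x#0)
    [x-0]y≈1 = proj₂ (proj₂ (#⇒invertible x#0))

  _*×_ : K× → K× → K×
  (x , x#0) *× (y , y#0) = x * y , x#0y#0→xy#0 x#0 y#0

  _/×_ : K× → K× → K×
  x /× y = x *× recip y

  _/_ : Carrier → K× → Carrier
  x / y = x * proj₁ (recip y)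

  neg-nonzero : ∀ {x} → x # 0# → - x # 0#
  neg-nonzero {x} x#0 with #⇒invertible (#-sym x#0)
  ... | y , y[0-x]≈1 , _ = invertibleˡ⇒# (y ,
    ≈-trans (*-congˡ (≈-trans (x-0≈x (- x)) (≈-sym (+-identityˡ (- x))))) y[0-x]≈1)

  ^-nonzero : ∀ {x} → x # 0# → ∀ n → x ^ n # 0#
  ^-nonzero x#0 zero    = 1#0
  ^-nonzero x#0 (suc n) = x#0y#0→xy#0 x#0 (^-nonzero x#0 n)

  ∏-nonzero : ∀ n {f : Fin n → Carrier} → (∀ i → f i # 0#) → ∏[ i < n ] f i # 0#
  ∏-nonzero zero    f#0 = 1#0
  ∏-nonzero (suc n) f#0 = x#0y#0→xy#0 (f#0 zero) (∏-nonzero n (λ i → f#0 (suc i)))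

  𝟙[_] : ∀ {p} {P : Set p} → Dec P → Carrier
  𝟙[ P? ] = if does P? then 1# else 0#

  Summation : Set → Set c
  Summation A = (A → Carrier) → Carrier

  ∑≤ : ℕ → Summation ℕ
  ∑≤ b f = ∑[ i ≤ b ] f (toℕ i)

  -- The sum over all vectors of a given length whose entries range over the
  -- index set of the given summation.
  ∑Vec : ∀ {A} → Summation A → ∀ n → Summation (Vec A n)
  ∑Vec ∑A zero    f = f []
  ∑Vec ∑A (suc n) f = ∑A λ x → ∑Vec ∑A n λ xs → f (x ∷ xs)

  -- (x;q)ₙ
  poch : Carrier → Carrier → ℕ → Carrier
  poch q x n = ∏[ i < n ] (1# - x * q ^ toℕ i)

  -- (x;q)ₙ is nonzero for all n.
  Generic : Carrier → Carrier → Set ℓ₂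
  Generic q x = ∀ j → 1# - x * q ^ j # 0#

  poch× : ∀ {q x} → Generic q x → ℕ → K×
  poch× {q} {x} gen n = poch q x n , ∏-nonzero n (λ i → gen (toℕ i))

  -- "Generic" means exactly that the denominators (q;q)ₙ, (sᵢ²;q)ₙ,
  -- ((sᵢ⁽ᵏ⁾)²;q)ₙ (i, k ≥ 1), ξᵢ and sᵢ do not vanish.  The square roots are the
  -- primitive data, so that ξᵢ = (√ξᵢ)² and sᵢ = (√sᵢ)².
  record Parameters : Set (c ⊔ℓ ℓ₂) where
    field
      q     : Carrier
      √ξ √s : ℕ → K×

    ξ : ℕ → K×
    ξ i = √ξ i *× √ξ i

    s : ℕ → K×
    s i = √s i *× √s i

    sξ : ℕ → K×
    sξ i = s i *× ξ i

    -- `τ k i` is sᵢ⁽ᵏ⁾, formed from the fixed roots.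
    τ : ℕ → ℕ → K×
    τ k i = √s (i ℕ.+ k) *× √ξ (i ℕ.+ k) *× √s i /× √ξ i

    field
      q-generic : Generic q q
      s-generic : ∀ i → Generic q (proj₁ (s (suc i)) ^ 2)
      τ-generic : ∀ k i → Generic q (proj₁ (τ (suc k) (suc i)) ^ 2)

  module Functions (P : Parameters) where
    open Parameters P

    -- W_{t,s}(i,j;k,l) as a function of t² and s².  When i < l the factors with
    -- i ∸ l are irrelevant because the indicator vanishes.
    W : (t² : K×) (s² : Carrier) → Generic q s² → (i j k l : ℕ) → Carrier
    W t² s² s²-generic i j k l =
      𝟙[ i ℕ.+ j ≟ k ℕ.+ l ] * 𝟙[ l ≤? i ] * (s² / t²) ^ l
        * (poch q (s² / t²) (i ∸ l) * poch q (proj₁ t²) l / poch× s²-generic i)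
        * (poch q q i / (poch× q-generic (i ∸ l) *× poch× q-generic l))

    -- In row r, the vertical edges in column c carry v_{r,c} below and
    -- v_{r-1,c} above, and the horizontal ones h_{r,c-1} and h_{r,c}.  The
    -- outer index of v is r = 0,…,n and that of h is r−1 = 0,…,n−1; the inner
    -- index of v is c−1 = 0,…,L−1 and that of h is c = 0,…,L.
    Boundary : ∀ {n} L → Partition → Partition → Vec ℕ n →
               Vec (Vec ℕ L) (suc n) → Vec (Vec ℕ (suc L)) n → Set
    Boundary {n} L Λ Μ a v h =
        (∀ c → lookup (lookup v zero) c ≡ mult Λ (toℕ c))
      × (∀ c → lookup (lookup v (fromℕ n)) c ≡ mult Μ (toℕ c))
      × (∀ r → lookup (lookup h r) zero ≡ lookup a r)
      × (∀ r → lookup (lookup h r) (fromℕ L) ≡ 0)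

    boundary? : ∀ {n} L Λ Μ (a : Vec ℕ n) v h → Dec (Boundary L Λ Μ a v h)
    boundary? L Λ Μ a v h =
            all? (λ c → _ ≟ _)
      ×-dec all? (λ c → _ ≟ _)
      ×-dec all? (λ r → _ ≟ _)
      ×-dec all? (λ r → _ ≟ _)

    -- The sum over all nonnegative labels is finite: by conservation at each
    -- vertex and h_{r,L} = 0, a configuration of nonzero weight satisfies
    -- ∑_c v_{r,c} + h_{r,0} = ∑_c v_{r-1,c} ≤ … ≤ ∑_c v_{0,c} ≤ λ₁, and
    -- h_{r,c} ≤ v_{r,c} for c ≥ 1.  Hence all its labels are at most λ₁, and it
    -- is enough to sum over labels in {0,…,λ₁}.
    ZW : ∀ {n} (L : ℕ) → Partition → Partition → Vec ℕ n → Vec K× n → Carrier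
    ZW {n} L Λ Μ a κ =
      ∑Vec (∑Vec (∑≤ (part Λ 0)) L) (suc n) λ v →
      ∑Vec (∑Vec (∑≤ (part Λ 0)) (suc L)) n λ h →
        𝟙[ boundary? L Λ Μ a v h ] *
        ∏[ r < n ] ∏[ c < L ]
          W (t² r c)
            (proj₁ (τ (suc (toℕ r)) (suc (toℕ c))) ^ 2) (τ-generic (toℕ r) (toℕ c))
            (lookup (lookup v (suc r)) c)
            (lookup (lookup h r) (inject₁ c))
            (lookup (lookup v (inject₁ r)) c)
            (lookup (lookup h r) (suc c))
      where
      t² : Fin n → Fin L → K×
      t² r c = sξ (suc (toℕ r) ℕ.+ suc (toℕ c)) /× lookup κ r

    -- 𝔽ˢ_{λ/μ}.  Compositions with a₁+⋯+aₙ = λ₁ − μ₁ have all entries ≤ λ₁, and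
    -- there are none if λ₁ < μ₁.  ZW is independent of L > l(λ), l(μ), and the
    -- least such L is used.
    𝔽ˢ : ∀ {n} → Partition → Partition → Vec K× n → Carrier
    𝔽ˢ {n} Λ Μ κ =
      ∑Vec (∑≤ (part Λ 0)) n λ a →
        𝟙[ sum a ℕ.+ part Μ 0 ≟ part Λ 0 ] *
        (∏[ i < n ]
          ((proj₁ (lookup κ i *× s 0 /× ξ 0) ^ lookup a i)
            * (poch q (proj₁ (sξ (suc (toℕ i)) /× lookup κ i)) (lookup a i)
                / poch× q-generic (lookup a i))))
        * ZW (suc (len Λ ⊔ len Μ)) Λ Μ a κ

    -- (−σ)^λ and c_σ(λ) for a sequence σ = (σ₀,σ₁,…); the factors of the
    -- infinite products beyond l(λ) are 1.
    negPow : (ℕ → Carrier) → Partition → Carrier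
    negPow σ Λ = ∏[ i < len Λ ] ((- σ (toℕ i)) ^ part Λ (toℕ i))

    cS : (ℕ → Carrier) → Partition → Carrier
    cS σ Λ = ∏[ i < len Λ ]
      (poch q (σ (suc (toℕ i)) ^ 2) (mult Λ (toℕ i)) / poch× q-generic (mult Λ (toℕ i)))

    negPow× : (σ : ℕ → K×) → Partition → K×
    negPow× σ Λ = negPow (λ i → proj₁ (σ i)) Λ ,
      ∏-nonzero (len Λ) (λ i → ^-nonzero (neg-nonzero (proj₂ (σ (toℕ i)))) (part Λ (toℕ i)))

    cS× : (σ : ℕ → Carrier) → (∀ i → Generic q (σ (suc i) ^ 2)) → Partition → K×
    cS× σ σ-generic Λ = cS σ Λ , ∏-nonzero (len Λ) λ i →
      x#0y#0→xy#0 (proj₂ (poch× (σ-generic (toℕ i)) (mult Λ (toℕ i))))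
                  (proj₂ (recip (poch× q-generic (mult Λ (toℕ i)))))

    -- 𝔽_{λ/μ}(κ₁,…,κₙ | Ξ,S)
    𝔽 : ∀ {n} → Partition → Partition → Vec K× n → Carrier
    𝔽 {n} Λ Μ κ =
        (negPow (λ i → proj₁ (τ n i)) Μ / negPow× s Λ)
      * (cS (λ i → proj₁ (τ n i)) Μ / cS× (λ i → proj₁ (s i)) s-generic Λ)
      * 𝔽ˢ Λ Μ κ

    -- 𝔽_λ(κ₁,…,κₙ | Ξ,S)
    𝔽-straight : ∀ {n} → Partition → Vec K× n → Carrier
    𝔽-straight Λ κ = 𝔽 Λ ∅ κ

open OverField public using (K×; Parameters)
open OverField.Parameters public using (sξ)
open OverField.Functions public using (𝔽-straight)

{-# OPTIONS --safe #-}

-- At κₙ = sₙξₙ the factor (κₙ⁻¹sₙξₙ;q)_{aₙ} = (1;q)_{aₙ} vanishes unless aₙ = 0.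
-- When aₙ = 0, no path enters the last row from the left; since μ = ∅, the
-- bottom edges of that row are empty as well, and the indicator i ≥ l then
-- forces all its horizontal edges, and by conservation its top edges, to be
-- empty.  The last row thus has weight 1, and deleting it leaves the partition
-- function with one row fewer and the same boundary conditions.

module Submission where

open import Defs
open import Algebra.Apartness.Bundles using (HeytingField; HeytingCommutativeRing)
open import Algebra.Bundles using (CommutativeRing)
import Algebra.Apartness.Properties.HeytingCommutativeRing as HeytingProperties
import Algebra.Properties.Monoid.Sum as FiniteSum
import Algebra.Properties.Semiring.Exp as Exponentiation
open import Data.Bool.Base using (if_then_else_)
open import Data.Fin.Base using (Fin; zero; suc; toℕ; fromℕ; inject₁)
open import Data.Fin.Properties using (all?; ¬∀⟶∃¬; toℕ-fromℕ; toℕ-inject₁)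
open import Data.Fin.Relation.Unary.Top using (view; ‵fromℕ; ‵inject₁)
open import Data.Nat.Base as ℕ using (ℕ; zero; suc; _≤_; _⊔_)
open import Data.Nat.Properties using (_≟_; _≤?_; n≤0⇒n≡0; m+n≡0⇒m≡0)
open import Data.Product.Base using (∃; _,_; proj₁; proj₂)
open import Data.Vec.Base using (Vec; []; _∷_; _∷ʳ_; lookup; replicate; sum)
open import Data.Vec.Properties using (foldr-∷ʳ; lookup-replicate)
open import Data.Vec.Relation.Binary.Pointwise.Extensional using (ext; Pointwise-≡⇒≡)
open import Function.Bundles using (_⇔_; mk⇔)
open import Level using (Level)
open import Relation.Binary.PropositionalEquality as ≡ using (_≡_; _≢_; refl)
import Relation.Binary.Reasoning.Setoid as SetoidReasoning
open import Relation.Nullary using (Dec; yes; no; ¬_; contradiction)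
open import Relation.Nullary.Decidable using (dec-true; dec-false; does-⇔)

-- Vectors with an entry appended at the end.

lookup-∷ʳ-inject₁ : ∀ {a} {A : Set a} {n} (xs : Vec A n) x i →
                    lookup (xs ∷ʳ x) (inject₁ i) ≡ lookup xs i
lookup-∷ʳ-inject₁ (y ∷ xs) x zero    = refl
lookup-∷ʳ-inject₁ (y ∷ xs) x (suc i) = lookup-∷ʳ-inject₁ xs x i

lookup-∷ʳ-fromℕ : ∀ {a} {A : Set a} {n} (xs : Vec A n) x →
                  lookup (xs ∷ʳ x) (fromℕ n) ≡ x
lookup-∷ʳ-fromℕ []       x = refl
lookup-∷ʳ-fromℕ (y ∷ xs) x = lookup-∷ʳ-fromℕ xs x

lookup-constant⇒≡ : ∀ {a} {A : Set a} {n} {x} (xs : Vec A n) →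
                    (∀ i → lookup xs i ≡ x) → xs ≡ replicate n x
lookup-constant⇒≡ {x = x} xs eq =
  Pointwise-≡⇒≡ (ext λ i → ≡.trans (eq i) (≡.sym (lookup-replicate i x)))

sum-∷ʳ-0 : ∀ {n} (a : Vec ℕ n) → sum (a ∷ʳ 0) ≡ sum a
-- The appended entry moves into the start value `0 + 0`, which computes to `0`.
sum-∷ʳ-0 a = foldr-∷ʳ (λ _ → ℕ) ℕ._+_ 0 a

module Truncation {c ℓ₁ ℓ₂ : Level} (F : HeytingField c ℓ₁ ℓ₂) where

  open HeytingField F using (Carrier; _≈_; #⇒invertible; heytingCommutativeRing)
  open HeytingCommutativeRing heytingCommutativeRing using (commutativeRing)
  open CommutativeRing commutativeRing
    using ( _*_; _+_; _-_; 0#; 1#; setoid; semiring; +-monoid; *-monoid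
          ; zeroˡ; zeroʳ; *-cong; *-congˡ; *-congʳ; *-identityˡ; *-identityʳ; +-identityʳ
          ; +-congˡ; -‿cong; -‿inverseʳ)
    renaming (refl to ≈-refl; sym to ≈-sym; trans to ≈-trans; reflexive to ≈-reflexive)
  open HeytingProperties heytingCommutativeRing using (x-0≈x)
  open FiniteSum +-monoid
    using (sum-cong-≋; sum-replicate-zero) renaming (sum to ∑)
  open FiniteSum *-monoid using ()
    renaming ( sum to ∏; sum-cong-≋ to ∏-cong; sum-init-last to ∏-init-last
             ; sum-replicate-zero to ∏-replicate-1)
  open Exponentiation semiring using (_^_)
  open OverField F hiding (Parameters; K×)

  private variable
    A : Set

  -- Quotients, indicators and products in the field.

  /-inverse : (x : K× F) → proj₁ x / x ≈ 1#
  /-inverse (x , x#0) =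
    ≈-trans (*-congʳ (≈-sym (x-0≈x x))) (proj₂ (proj₂ (#⇒invertible x#0)))

  -- The inverse comes from an apartness proof and does not compute, even for `1#`; replacing the
  -- numerator by the denominator reduces the quotient to `/-inverse`.
  /-one : ∀ {x} (y : K× F) → x ≈ 1# → proj₁ y ≈ 1# → x / y ≈ 1#
  /-one y x≈1 y≈1 = ≈-trans (*-congʳ (≈-trans x≈1 (≈-sym y≈1))) (/-inverse y)

  *-one : ∀ {x y} → x ≈ 1# → y ≈ 1# → x * y ≈ 1#
  *-one x≈1 y≈1 = ≈-trans (*-cong x≈1 y≈1) (*-identityˡ 1#)

  *-zeroˡ : ∀ {x} y → x ≈ 0# → x * y ≈ 0#
  *-zeroˡ y x≈0 = ≈-trans (*-congʳ x≈0) (zeroˡ y)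

  *-zeroʳ : ∀ x {y} → y ≈ 0# → x * y ≈ 0#
  *-zeroʳ x y≈0 = ≈-trans (*-congˡ y≈0) (zeroʳ x)

  𝟙-true : ∀ {p} {P : Set p} (P? : Dec P) → P → 𝟙[ P? ] ≈ 1#
  𝟙-true P? p = ≈-reflexive (≡.cong (if_then 1# else 0#) (dec-true P? p))

  𝟙-false : ∀ {p} {P : Set p} (P? : Dec P) → ¬ P → 𝟙[ P? ] ≈ 0#
  𝟙-false P? ¬p = ≈-reflexive (≡.cong (if_then 1# else 0#) (dec-false P? ¬p))

  𝟙-cong : ∀ {p r} {P : Set p} {R : Set r} (P? : Dec P) (R? : Dec R) →
           P ⇔ R → 𝟙[ P? ] ≈ 𝟙[ R? ]
  𝟙-cong P? R? P⇔R = ≈-reflexive (≡.cong (if_then 1# else 0#) (does-⇔ P⇔R P? R?))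

  ∏-one : ∀ n {f : Fin n → Carrier} → (∀ i → f i ≈ 1#) → ∏ f ≈ 1#
  ∏-one n f≈1 = ≈-trans (∏-cong f≈1) (∏-replicate-1 n)

  ∏-zero : ∀ {n} (f : Fin n → Carrier) i → f i ≈ 0# → ∏ f ≈ 0#
  ∏-zero f zero    fi≈0 = *-zeroˡ _ fi≈0
  ∏-zero f (suc i) fi≈0 = *-zeroʳ _ (∏-zero (λ j → f (suc j)) i fi≈0)

  ∏-snoc : ∀ {n} (f : Fin (suc n) → Carrier) {g : Fin n → Carrier} {x} →
           (∀ i → f (inject₁ i) ≈ g i) → f (fromℕ n) ≈ x → ∏ f ≈ ∏ g * x
  ∏-snoc f f≈g f≈x = ≈-trans (∏-init-last f) (*-cong (∏-cong f≈g) f≈x)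

  -- The factor with exponent 0 is `1# - x`, which already vanishes.
  poch-1-suc : ∀ q {x} n → x ≈ 1# → poch q x (suc n) ≈ 0#
  poch-1-suc q {x} n x≈1 = *-zeroˡ _ (begin
    1# - x * 1#  ≈⟨ +-congˡ (-‿cong (*-one x≈1 ≈-refl)) ⟩
    1# - 1#      ≈⟨ -‿inverseʳ 1# ⟩
    0#           ∎)
    where open SetoidReasoning setoid

  -- Finite sums over labels and over vectors of labels.

  Congruent : Summation A → Set _
  Congruent ∑A = ∀ f g → (∀ x → f x ≈ g x) → ∑A f ≈ ∑A g

  -- x₀ occurs exactly once in the index set of ∑A.
  Includes : Summation A → A → Set _
  Includes ∑A x₀ = ∀ f → (∀ x → x ≢ x₀ → f x ≈ 0#) → ∑A f ≈ f x₀

  -- The sum collapses to its value at `x₀`, and that value is zero as well.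
  Includes⇒zero : {∑A : Summation A} {x₀ : A} → Includes ∑A x₀ →
                  ∀ f → (∀ x → f x ≈ 0#) → ∑A f ≈ 0#
  Includes⇒zero {x₀ = x₀} inc f f≈0 = ≈-trans (inc f λ x _ → f≈0 x) (f≈0 x₀)

  ∑≤-cong : ∀ b → Congruent (∑≤ b)
  ∑≤-cong b f g f≈g = sum-cong-≋ {suc b} λ i → f≈g (toℕ i)

  ∑≤-includes-0 : ∀ b → Includes (∑≤ b) 0
  ∑≤-includes-0 b f f≈0 = begin
    f 0 + ∑ {b} (λ i → f (suc (toℕ i)))  ≈⟨ +-congˡ (sum-cong-≋ {b} λ i → f≈0 _ λ ()) ⟩
    f 0 + ∑ {b} (λ _ → 0#)               ≈⟨ +-congˡ (sum-replicate-zero b) ⟩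
    f 0 + 0#                             ≈⟨ +-identityʳ (f 0) ⟩
    f 0                                  ∎
    where open SetoidReasoning setoid

  ∑Vec-cong : {∑A : Summation A} → Congruent ∑A → ∀ n → Congruent (∑Vec ∑A n)
  ∑Vec-cong cong zero    f g f≈g = f≈g []
  ∑Vec-cong cong (suc n) f g f≈g = cong _ _ λ x →
    ∑Vec-cong cong n (λ xs → f (x ∷ xs)) (λ xs → g (x ∷ xs)) λ xs → f≈g (x ∷ xs)

  ∑Vec-includes : {∑A : Summation A} {x₀ : A} → Includes ∑A x₀ →
                  ∀ n → Includes (∑Vec ∑A n) (replicate n x₀)
  ∑Vec-includes inc zero    f f≈0 = ≈-refl
  ∑Vec-includes {x₀ = x₀} inc (suc n) f f≈0 = ≈-trans
    -- A vector other than the constant one differs from it in the head, where the whole inner sum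
    -- vanishes, or in the tail, where induction applies.
    (inc _ λ x x≢x₀ → Includes⇒zero (∑Vec-includes inc n) (λ xs → f (x ∷ xs))
      λ xs → f≈0 (x ∷ xs) λ { refl → x≢x₀ refl })
    (∑Vec-includes inc n (λ xs → f (x₀ ∷ xs)) λ xs xs≢ → f≈0 _ λ { refl → xs≢ refl })

  -- Entries are summed from first to last, so the last one is already the innermost variable and
  -- only the grouping changes.
  ∑Vec-∷ʳ : {∑A : Summation A} → Congruent ∑A → ∀ n f →
            ∑Vec ∑A (suc n) f ≈ ∑Vec ∑A n (λ xs → ∑A λ x → f (xs ∷ʳ x))
  ∑Vec-∷ʳ cong zero    f = ≈-refl
  ∑Vec-∷ʳ cong (suc n) f = cong _ _ λ x → ∑Vec-∷ʳ cong n (λ xs → f (x ∷ xs))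

  -- The common form of all three truncations: of the composition, of the vertical labels and of the
  -- horizontal labels.
  ∑Vec-dropLast : {∑A : Summation A} {x₀ : A} → Congruent ∑A → Includes ∑A x₀ →
                  ∀ n f g →
                  (∀ xs x → x ≢ x₀ → f (xs ∷ʳ x) ≈ 0#) →
                  (∀ xs → f (xs ∷ʳ x₀) ≈ g xs) →
                  ∑Vec ∑A (suc n) f ≈ ∑Vec ∑A n g
  ∑Vec-dropLast cong inc n f g f≈0 f≈g = ≈-trans (∑Vec-∷ʳ cong n f)
    (∑Vec-cong cong n _ g λ xs →
      ≈-trans (inc (λ x → f (xs ∷ʳ x)) (f≈0 xs)) (f≈g xs))

  -- The sum over compositions, for abstract boundary factors and partition functions.

  module Compositions
    (φ : ℕ → K× F → ℕ → Carrier) (φ-0 : ∀ i k → φ i k 0 ≈ 1#)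
    (Z : ∀ {n} → Vec ℕ n → Vec (K× F) n → Carrier)
    (Z-∷ʳ : ∀ {n} (a : Vec ℕ n) κ k → Z (a ∷ʳ 0) (κ ∷ʳ k) ≈ Z a κ)
    where

    factor : ∀ {n} → Vec (K× F) n → Vec ℕ n → Fin n → Carrier
    factor κ a i = φ (toℕ i) (lookup κ i) (lookup a i)

    ∏-factor-∷ʳ : ∀ {n} κ k (a : Vec ℕ n) x →
      ∏ (factor (κ ∷ʳ k) (a ∷ʳ x)) ≈ ∏ (factor κ a) * φ n k x
    ∏-factor-∷ʳ {n} κ k a x = ∏-snoc (factor (κ ∷ʳ k) (a ∷ʳ x))
      (λ i → ≈-reflexive (φ-cong (toℕ-inject₁ i)
        (lookup-∷ʳ-inject₁ κ k i) (lookup-∷ʳ-inject₁ a x i)))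
      (≈-reflexive (φ-cong (toℕ-fromℕ n) (lookup-∷ʳ-fromℕ κ k) (lookup-∷ʳ-fromℕ a x)))
      where
      φ-cong : ∀ {i i′ k k′ x x′} → i ≡ i′ → k ≡ k′ → x ≡ x′ → φ i k x ≡ φ i′ k′ x′
      φ-cong refl refl refl = refl

    -- The summand `0` is `part ∅ 0`, kept so that `term` agrees by computation with the summand of
    -- `𝔽ˢ` at `∅`.
    term : ∀ {n} → ℕ → Vec (K× F) n → Vec ℕ n → Carrier
    term N κ a = 𝟙[ sum a ℕ.+ 0 ≟ N ] * ∏ (factor κ a) * Z a κ

    compositionSum : ∀ {n} → ℕ → Vec (K× F) n → Carrier
    compositionSum {n} N κ = ∑Vec (∑≤ N) n (term N κ)

    -- The last factor kills every composition with nonzero last part; for last part 0 that factor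
    -- is 1 and `Z-∷ʳ` removes the row. The appended row has index `n`, as rows count from 0.
    compositionSum-∷ʳ : ∀ {n} N (κ : Vec (K× F) n) k → (∀ x → x ≢ 0 → φ n k x ≈ 0#) →
                        compositionSum N (κ ∷ʳ k) ≈ compositionSum N κ
    compositionSum-∷ʳ {n} N κ k φ-vanishes =
      ∑Vec-dropLast (∑≤-cong N) (∑≤-includes-0 N) n (term N (κ ∷ʳ k)) (term N κ)
        (λ a x x≢0 → *-zeroˡ _ (*-zeroʳ _ (≈-trans (∏-factor-∷ʳ κ k a x)
          (*-zeroʳ _ (φ-vanishes x x≢0)))))
        (λ a → *-cong
          (*-cong (≈-reflexive (≡.cong (λ t → 𝟙[ t ℕ.+ 0 ≟ N ]) (sum-∷ʳ-0 a)))
            (≈-trans (∏-factor-∷ʳ κ k a 0)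
              (≈-trans (*-congˡ (φ-0 n k)) (*-identityʳ (∏ (factor κ a))))))
          (Z-∷ʳ a κ k))

  -- Vertex weights.

  module _ (P : Parameters F) where

    open OverField.Parameters P hiding (sξ)
    open Functions P hiding (𝔽-straight)

    -- Row and column are natural numbers counted from 0, so that a row keeps its weight when the
    -- number of rows changes.
    vertexWeight : ℕ → K× F → ℕ → (i j k l : ℕ) → Carrier
    vertexWeight r κ c = W (sξ P (suc r ℕ.+ suc c) /× κ)
      (proj₁ (τ (suc r) (suc c)) ^ 2) (τ-generic r c)

    -- All powers and Pochhammer symbols are empty products; the indicators and quotients of ones
    -- remain.
    vertexWeight-empty : ∀ r κ c → vertexWeight r κ c 0 0 0 0 ≈ 1#
    vertexWeight-empty r κ c = *-one
      (*-one (*-one (*-one (𝟙-true (0 ≟ 0) refl) (𝟙-true (0 ≤? 0) ℕ.z≤n)) ≈-refl)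
             (/-one (poch× (τ-generic r c) 0) (*-one ≈-refl ≈-refl) ≈-refl))
      (/-one (poch× q-generic 0 *× poch× q-generic 0) ≈-refl (*-one ≈-refl ≈-refl))

    vertexWeight-nonconserving : ∀ r κ c i j k l → i ℕ.+ j ≢ k ℕ.+ l →
                                 vertexWeight r κ c i j k l ≈ 0#
    vertexWeight-nonconserving r κ c i j k l ≢ =
      *-zeroˡ _ (*-zeroˡ _ (*-zeroˡ _ (*-zeroˡ _ (𝟙-false (i ℕ.+ j ≟ k ℕ.+ l) ≢))))

    vertexWeight-blocked : ∀ r κ c i j k l → ¬ l ≤ i → vertexWeight r κ c i j k l ≈ 0#
    vertexWeight-blocked r κ c i j k l ≰ =
      *-zeroˡ _ (*-zeroˡ _ (*-zeroˡ _ (*-zeroʳ _ (𝟙-false (l ≤? i) ≰))))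

    -- The weights are a parameter because comparing unfolded copies of W is infeasible.
    module Rows
      (vertexWeight : ℕ → K× F → ℕ → (i j k l : ℕ) → Carrier)
      (vertexWeight-empty : ∀ r κ c → vertexWeight r κ c 0 0 0 0 ≈ 1#)
      (vertexWeight-nonconserving : ∀ r κ c i j k l → i ℕ.+ j ≢ k ℕ.+ l →
                                    vertexWeight r κ c i j k l ≈ 0#)
      (vertexWeight-blocked : ∀ r κ c i j k l → ¬ l ≤ i → vertexWeight r κ c i j k l ≈ 0#)
      where

      -- Single rows, in particular those with empty bottom edges.

      rowWeight : ∀ {L} → ℕ → K× F → Vec ℕ L → Vec ℕ L → Vec ℕ (suc L) → Carrier
      rowWeight {L} r κ below above h = ∏ {L} λ c → vertexWeight r κ (toℕ c)
        (lookup below c) (lookup h (inject₁ c)) (lookup above c) (lookup h (suc c))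

      rowWeight-cong : ∀ {L r r′ k k′} {b b′ t t′ : Vec ℕ L} {h h′} →
                       r ≡ r′ → k ≡ k′ → b ≡ b′ → t ≡ t′ → h ≡ h′ →
                       rowWeight r k b t h ≡ rowWeight r′ k′ b′ t′ h′
      rowWeight-cong refl refl refl refl refl = refl

      module _ {L : ℕ} (r : ℕ) (k : K× F) (above : Vec ℕ L) where

        private
          0ᴸ   = replicate L 0
          0ᴸ⁺¹ = replicate (suc L) 0

        rowWeight-empty : (∀ c → lookup above c ≡ 0) → rowWeight r k 0ᴸ above 0ᴸ⁺¹ ≈ 1#
        rowWeight-empty above≡0 = ∏-one L λ c → ≈-trans
          (≈-reflexive (vertexWeight-cong (lookup-replicate c 0)
            (lookup-replicate (inject₁ c) 0) (above≡0 c) (lookup-replicate (suc c) 0)))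
          (vertexWeight-empty r k (toℕ c))
          where
          vertexWeight-cong : ∀ {c i i′ j j′ l l′ m m′} →
            i ≡ i′ → j ≡ j′ → l ≡ l′ → m ≡ m′ →
            vertexWeight r k c i j l m ≡ vertexWeight r k c i′ j′ l′ m′
          vertexWeight-cong refl refl refl refl = refl

        -- Nothing enters the vertex in column `c` from below or from the left, so a nonzero top
        -- label violates conservation.
        rowWeight-top : ∀ c → lookup above c ≢ 0 → rowWeight r k 0ᴸ above 0ᴸ⁺¹ ≈ 0#
        rowWeight-top c ≢0 = ∏-zero _ c (vertexWeight-nonconserving r k (toℕ c)
          (lookup 0ᴸ c) (lookup 0ᴸ⁺¹ (inject₁ c)) (lookup above c) (lookup 0ᴸ⁺¹ (suc c))
          λ conserved → ≢0 (m+n≡0⇒m≡0 (lookup above c) (≡.trans (≡.sym conserved)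
            (≡.cong₂ ℕ._+_ (lookup-replicate c 0) (lookup-replicate (inject₁ c) 0)))))

        -- The indicator `l ≤ i` with `i = 0` blocks a nonzero right label. Position `zero` of `h`
        -- is no vertex's right edge and is left to the boundary conditions.
        rowWeight-right : ∀ h c → lookup h (suc c) ≢ 0 → rowWeight r k 0ᴸ above h ≈ 0#
        rowWeight-right h c ≢0 = ∏-zero _ c (vertexWeight-blocked r k (toℕ c)
          (lookup 0ᴸ c) (lookup h (inject₁ c)) (lookup above c) (lookup h (suc c))
          λ l≤i → ≢0 (n≤0⇒n≡0 (≡.subst (lookup h (suc c) ≤_) (lookup-replicate c 0) l≤i)))

      -- Configurations with one row appended.

      row : ∀ {n L} → Vec (K× F) n → Vec (Vec ℕ L) (suc n) → Vec (Vec ℕ (suc L)) n →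
            Fin n → Carrier
      row κ v h r = rowWeight (toℕ r) (lookup κ r)
        (lookup v (suc r)) (lookup v (inject₁ r)) (lookup h r)

      configWeight : ∀ {n} L → Partition → Partition → Vec ℕ n → Vec (K× F) n →
                     Vec (Vec ℕ L) (suc n) → Vec (Vec ℕ (suc L)) n → Carrier
      configWeight L Λ Μ a κ v h = 𝟙[ boundary? L Λ Μ a v h ] * ∏ (row κ v h)

      configWeight-boundary : ∀ {n} L Λ Μ a (κ : Vec (K× F) n) v h →
        ¬ Boundary L Λ Μ a v h → configWeight L Λ Μ a κ v h ≈ 0#
      configWeight-boundary L Λ Μ a κ v h ¬b =
        *-zeroˡ (∏ (row κ v h)) (𝟙-false (boundary? L Λ Μ a v h) ¬b)

      configWeight-rows : ∀ {n} L Λ Μ a (κ : Vec (K× F) n) v h →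
        ∏ (row κ v h) ≈ 0# → configWeight L Λ Μ a κ v h ≈ 0#
      configWeight-rows L Λ Μ a κ v h = *-zeroʳ 𝟙[ boundary? L Λ Μ a v h ]

      -- Row `r` reads the vertical labels at `inject₁ r` and `suc r`, so the earlier rows do not
      -- see `w`, and the new row lies between the former bottom labels and `w`.
      rows-∷ʳ : ∀ {n L} κ k (v : Vec (Vec ℕ L) (suc n)) w h g →
        ∏ (row (κ ∷ʳ k) (v ∷ʳ w) (h ∷ʳ g))
          ≈ ∏ (row κ v h) * rowWeight n k w (lookup v (fromℕ n)) g
      rows-∷ʳ {n} κ k v w h g = ∏-snoc (row (κ ∷ʳ k) (v ∷ʳ w) (h ∷ʳ g))
        (λ r → ≈-reflexive (rowWeight-cong (toℕ-inject₁ r)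
          -- The index `suc (inject₁ r)` is `inject₁ (suc r)` by computation.
          (lookup-∷ʳ-inject₁ κ k r) (lookup-∷ʳ-inject₁ v w (suc r))
          (lookup-∷ʳ-inject₁ v w (inject₁ r)) (lookup-∷ʳ-inject₁ h g r)))
        (≈-reflexive (rowWeight-cong (toℕ-fromℕ n)
          (lookup-∷ʳ-fromℕ κ k) (lookup-∷ʳ-fromℕ v w)
          (lookup-∷ʳ-inject₁ v w (fromℕ n)) (lookup-∷ʳ-fromℕ h g)))

      rows-∷ʳ-zero : ∀ {n L} κ k (v : Vec (Vec ℕ L) (suc n)) w h g →
        rowWeight n k w (lookup v (fromℕ n)) g ≈ 0# →
        ∏ (row (κ ∷ʳ k) (v ∷ʳ w) (h ∷ʳ g)) ≈ 0#
      rows-∷ʳ-zero κ k v w h g last≈0 =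
        ≈-trans (rows-∷ʳ κ k v w h g) (*-zeroʳ (∏ (row κ v h)) last≈0)

      rows-∷ʳ-one : ∀ {n L} κ k (v : Vec (Vec ℕ L) (suc n)) w h g →
        rowWeight n k w (lookup v (fromℕ n)) g ≈ 1# →
        ∏ (row (κ ∷ʳ k) (v ∷ʳ w) (h ∷ʳ g)) ≈ ∏ (row κ v h)
      rows-∷ʳ-one κ k v w h g last≈1 = ≈-trans (rows-∷ʳ κ k v w h g)
        (≈-trans (*-congˡ last≈1) (*-identityʳ (∏ (row κ v h))))

      module _ {n L : ℕ} (Λ : Partition) (a : Vec ℕ n) (κ : Vec (K× F) n) (k : K× F)
               (v : Vec (Vec ℕ L) (suc n)) where

        private
          0ᴸ   = replicate L 0
          0ᴸ⁺¹ = replicate (suc L) 0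
          a⁺   = a ∷ʳ 0
          κ⁺   = κ ∷ʳ k
          vₙ   = lookup v (fromℕ n)

        -- The prescribed bottom labels `mult ∅ c` all compute to 0.
        configWeight-bottom : ∀ w (h : Vec (Vec ℕ (suc L)) (suc n)) → w ≢ 0ᴸ →
          configWeight L Λ ∅ a⁺ κ⁺ (v ∷ʳ w) h ≈ 0#
        configWeight-bottom w h w≢0 =
          configWeight-boundary L Λ ∅ a⁺ κ⁺ (v ∷ʳ w) h λ (_ , bottom , _) →
            w≢0 (lookup-constant⇒≡ w λ c → ≡.trans
              (≡.cong (λ u → lookup u c) (≡.sym (lookup-∷ʳ-fromℕ v w))) (bottom c))

        -- A nonzero label at position `zero` contradicts the last entry 0 of `a⁺`; at any later
        -- position it is the right label of a vertex with empty bottom edge.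
        configWeight-horizontal : ∀ (h : Vec (Vec ℕ (suc L)) n) g → g ≢ 0ᴸ⁺¹ →
          configWeight L Λ ∅ a⁺ κ⁺ (v ∷ʳ 0ᴸ) (h ∷ʳ g) ≈ 0#
        configWeight-horizontal h g g≢0 = byPosition
          (¬∀⟶∃¬ (suc L) (λ c → lookup g c ≡ 0) (λ c → lookup g c ≟ 0)
                 (λ g≡0 → g≢0 (lookup-constant⇒≡ g g≡0)))
          where
          byPosition : ∃ (λ c → lookup g c ≢ 0) →
                       configWeight L Λ ∅ a⁺ κ⁺ (v ∷ʳ 0ᴸ) (h ∷ʳ g) ≈ 0#
          byPosition (zero , ≢0) =
            configWeight-boundary L Λ ∅ a⁺ κ⁺ (v ∷ʳ 0ᴸ) (h ∷ʳ g) λ (_ , _ , left , _) →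
              ≢0 (let open ≡.≡-Reasoning in begin
                lookup g zero
                  ≡⟨ ≡.cong (λ u → lookup u zero) (lookup-∷ʳ-fromℕ h g) ⟨
                lookup (lookup (h ∷ʳ g) (fromℕ n)) zero  ≡⟨ left (fromℕ n) ⟩
                lookup a⁺ (fromℕ n)                      ≡⟨ lookup-∷ʳ-fromℕ a 0 ⟩
                0                                        ∎)
          byPosition (suc c , ≢0) =
            configWeight-rows L Λ ∅ a⁺ κ⁺ (v ∷ʳ 0ᴸ) (h ∷ʳ g)
              (rows-∷ʳ-zero κ k v 0ᴸ h g (rowWeight-right n k vₙ g c ≢0))

        -- In the longer configuration the labels `vₙ` are interior and unconstrained by the
        -- boundary; the hypothesis on them supplies the bottom condition of the shorter one.
        boundary-∷ʳ : ∀ (h : Vec (Vec ℕ (suc L)) n) → (∀ c → lookup vₙ c ≡ 0) →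
          Boundary L Λ ∅ a⁺ (v ∷ʳ 0ᴸ) (h ∷ʳ 0ᴸ⁺¹)
            ⇔ Boundary L Λ ∅ a v h
        boundary-∷ʳ h v≡0 = mk⇔
          (λ (top , _ , left , right) →
              (λ c → ≡.trans (≡.cong (λ u → lookup u c) (≡.sym v₀)) (top c))
            , v≡0
            , (λ r → ≡.trans (≡.cong (λ u → lookup u zero) (≡.sym (hᵢ r)))
                      (≡.trans (left (inject₁ r)) (lookup-∷ʳ-inject₁ a 0 r)))
            , (λ r → ≡.trans (≡.cong (λ u → lookup u (fromℕ L)) (≡.sym (hᵢ r)))
                      (right (inject₁ r))))
          (λ (top , _ , left , right) →
              (λ c → ≡.trans (≡.cong (λ u → lookup u c) v₀) (top c))
            , (λ c → ≡.trans (≡.cong (λ u → lookup u c) (lookup-∷ʳ-fromℕ v _))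
                             (lookup-replicate c 0))
            , left⁺ left
            , right⁺ right)
          where
          h⁺ = h ∷ʳ 0ᴸ⁺¹
          v₀ = lookup-∷ʳ-inject₁ v 0ᴸ zero
          hᵢ = lookup-∷ʳ-inject₁ h 0ᴸ⁺¹
          hₙ = lookup-∷ʳ-fromℕ h 0ᴸ⁺¹

          left⁺ : (∀ r → lookup (lookup h r) zero ≡ lookup a r) →
                  ∀ r → lookup (lookup h⁺ r) zero ≡ lookup (a ∷ʳ 0) r
          left⁺ left r with view r
          ... | ‵fromℕ = ≡.trans (≡.cong (λ u → lookup u zero) hₙ)
                                 (≡.sym (lookup-∷ʳ-fromℕ a 0))
          ... | ‵inject₁ i = ≡.trans (≡.cong (λ u → lookup u zero) (hᵢ i))
                               (≡.trans (left i) (≡.sym (lookup-∷ʳ-inject₁ a 0 i)))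

          right⁺ : (∀ r → lookup (lookup h r) (fromℕ L) ≡ 0) →
                   ∀ r → lookup (lookup h⁺ r) (fromℕ L) ≡ 0
          right⁺ right r with view r
          ... | ‵fromℕ = ≡.trans (≡.cong (λ u → lookup u (fromℕ L)) hₙ)
                                 (lookup-replicate (fromℕ L) 0)
          ... | ‵inject₁ i = ≡.trans (≡.cong (λ u → lookup u (fromℕ L)) (hᵢ i)) (right i)

        -- If `vₙ` is zero, the appended row has weight 1. Otherwise both sides vanish: the left by
        -- conservation in the appended row, the right by the bottom boundary condition.
        configWeight-∷ʳ : ∀ (h : Vec (Vec ℕ (suc L)) n) →
          configWeight L Λ ∅ a⁺ κ⁺ (v ∷ʳ 0ᴸ) (h ∷ʳ 0ᴸ⁺¹) ≈ configWeight L Λ ∅ a κ v h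
        configWeight-∷ʳ h = byTop (all? λ c → lookup vₙ c ≟ 0)
          where
          byTop : Dec (∀ c → lookup vₙ c ≡ 0) →
            configWeight L Λ ∅ a⁺ κ⁺ (v ∷ʳ 0ᴸ) (h ∷ʳ 0ᴸ⁺¹) ≈ configWeight L Λ ∅ a κ v h
          byTop (yes v≡0) = *-cong
            (𝟙-cong (boundary? L Λ ∅ a⁺ (v ∷ʳ 0ᴸ) (h ∷ʳ 0ᴸ⁺¹)) (boundary? L Λ ∅ a v h)
                    (boundary-∷ʳ h v≡0))
            (rows-∷ʳ-one κ k v 0ᴸ h 0ᴸ⁺¹ (rowWeight-empty n k vₙ v≡0))
          byTop (no v≢0) =
            let (c , ≢0) = ¬∀⟶∃¬ L (λ c → lookup vₙ c ≡ 0) (λ c → lookup vₙ c ≟ 0) v≢0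
            in ≈-trans
              (configWeight-rows L Λ ∅ a⁺ κ⁺ (v ∷ʳ 0ᴸ) (h ∷ʳ 0ᴸ⁺¹)
                (rows-∷ʳ-zero κ k v 0ᴸ h 0ᴸ⁺¹ (rowWeight-top n k vₙ c ≢0)))
              (≈-sym (configWeight-boundary L Λ ∅ a κ v h λ (_ , bottom , _) → ≢0 (bottom c)))

      -- Deleting the last row of the partition function.

      horizontalSum : ∀ {n} L → Partition → Partition → Vec ℕ n → Vec (K× F) n →
                      Vec (Vec ℕ L) (suc n) → Carrier
      horizontalSum {n} L Λ Μ a κ v =
        ∑Vec (∑Vec (∑≤ (part Λ 0)) (suc L)) n (configWeight L Λ Μ a κ v)

      partitionFunction : ∀ {n} → ℕ → Partition → Partition → Vec ℕ n → Vec (K× F) n → Carrier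
      partitionFunction {n} L Λ Μ a κ =
        ∑Vec (∑Vec (∑≤ (part Λ 0)) L) (suc n) (horizontalSum L Λ Μ a κ)

      -- The vertical labels are truncated first, because the horizontal labels of the last row are
      -- forced to be zero only once its bottom edges are empty.
      partitionFunction-∷ʳ : ∀ {n} L Λ (a : Vec ℕ n) κ k →
        partitionFunction L Λ ∅ (a ∷ʳ 0) (κ ∷ʳ k) ≈ partitionFunction L Λ ∅ a κ
      partitionFunction-∷ʳ {n} L Λ a κ k =
        ∑Vec-dropLast (∑Vec-cong label-cong L) (∑Vec-includes label-includes L) (suc n)
          (horizontalSum L Λ ∅ (a ∷ʳ 0) (κ ∷ʳ k)) (horizontalSum L Λ ∅ a κ)
          (λ v w w≢0 → Includes⇒zero
            (∑Vec-includes (∑Vec-includes label-includes (suc L)) (suc n))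
            (configWeight L Λ ∅ (a ∷ʳ 0) (κ ∷ʳ k) (v ∷ʳ w))
            λ h → configWeight-bottom Λ a κ k v w h w≢0)
          (λ v → ∑Vec-dropLast (∑Vec-cong label-cong (suc L))
                               (∑Vec-includes label-includes (suc L)) n
            (configWeight L Λ ∅ (a ∷ʳ 0) (κ ∷ʳ k) (v ∷ʳ replicate L 0))
            (configWeight L Λ ∅ a κ v)
            (configWeight-horizontal Λ a κ k v)
            (configWeight-∷ʳ Λ a κ k v))
        where
        label-cong : Congruent (∑≤ (part Λ 0))
        label-cong = ∑≤-cong (part Λ 0)
        label-includes : Includes (∑≤ (part Λ 0)) 0
        label-includes = ∑≤-includes-0 (part Λ 0)

    open Rows vertexWeight vertexWeight-empty vertexWeight-nonconserving vertexWeight-blocked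

    -- With the actual vertex weights inserted, `partitionFunction` unfolds to `ZW`.
    ZW-∷ʳ : ∀ {n} L Λ (a : Vec ℕ n) κ k →
            ZW L Λ ∅ (a ∷ʳ 0) (κ ∷ʳ k) ≈ ZW L Λ ∅ a κ
    ZW-∷ʳ L Λ a κ k = partitionFunction-∷ʳ L Λ a κ k

    -- Boundary factors and the truncation of `𝔽ˢ`.

    boundaryFactor : ℕ → K× F → ℕ → Carrier
    boundaryFactor i k x =
      (proj₁ (k *× s 0 /× ξ 0) ^ x)
        * (poch q (proj₁ (sξ P (suc i) /× k)) x / poch× q-generic x)

    boundaryFactor-0 : ∀ i k → boundaryFactor i k 0 ≈ 1#
    boundaryFactor-0 i k = *-one ≈-refl (/-one (poch× q-generic 0) ≈-refl ≈-refl)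

    -- The base of the Pochhammer symbol is `sξ P (suc i)` divided by itself, hence 1.
    boundaryFactor-vanishes : ∀ i x → x ≢ 0 → boundaryFactor i (sξ P (suc i)) x ≈ 0#
    boundaryFactor-vanishes i zero    x≢0 = contradiction refl x≢0
    boundaryFactor-vanishes i (suc x) x≢0 =
      *-zeroʳ _ (*-zeroˡ _ (poch-1-suc q x (/-inverse (sξ P (suc i)))))

    𝔽ˢ-∷ʳ : ∀ {n} Λ (κ : Vec (K× F) n) → 𝔽ˢ Λ ∅ (κ ∷ʳ sξ P (suc n)) ≈ 𝔽ˢ Λ ∅ κ
    𝔽ˢ-∷ʳ {n} Λ κ = compositionSum-∷ʳ (part Λ 0) κ (sξ P (suc n)) (boundaryFactor-vanishes n)
      where
      open Compositions boundaryFactor boundaryFactor-0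
        -- The number of columns depends on `Λ` and `∅` only, so it is the same before and after the
        -- deletion.
        (ZW (suc (len Λ ⊔ len ∅)) Λ ∅) (ZW-∷ʳ (suc (len Λ ⊔ len ∅)) Λ)

corollary5p8 : ∀ {c ℓ₁ ℓ₂} (F : HeytingField c ℓ₁ ℓ₂) (P : Parameters F)
    (Λ : Partition) (m : ℕ) → 2 ≤ suc m → (κ : Vec (K× F) m) →
    HeytingField._≈_ F (𝔽-straight F P Λ (κ ∷ʳ sξ P (suc m))) (𝔽-straight F P Λ κ)
-- The prefactors involve `τ (suc m)` and `τ m` only in products over `len ∅` indices. As `len ∅`
-- computes to 0, both products are `1#` and the prefactors agree by computation.
corollary5p8 F P Λ m _ κ = *-congˡ (Truncation.𝔽ˢ-∷ʳ F P Λ κ)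
  where open HeytingField F using (*-congˡ)
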